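{- A (possibly infinite) graph $G$ is $\omega$-evadible if and only if at least one of the following holds: (1) for every $k\in\mathbb{N}$, $G$ contains a path on $k$ vertices as a subgraph; (2) for every $k\in\mathbb{N}$, there is a vertex $v_k\in V(G)$ lying on $k$ pairwise edge-disjoint cycles of $G$.
   Context: Cat Herding is played on a simple, possibly infinite graph $G$. The cat first places its token on a vertex. Then the players alternate, the herder moving first: the herder deletes one edge of the current graph, and then, unless the cat's current vertex has degree $0$ in the current graph, the cat moves its token along a finite path with at least one edge in the current graph to a different vertex. The cat is captured when its vertex has degree $0$ in the current graph. $G$ is $k$-evadible if the cat has a strategy (including its choice of starting vertex) that, against every herder strategy, yields a legal cat move after each of the first $k-1$ edge deletions; $G$ is $\omega$-evadible if it is $k$-evadible for every $k\in\mathbb{N}$. -}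

module Defs where

open import Level using (Level) renaming (suc to lsuc)
open import Data.Nat.Base using (ℕ; zero; suc; _≤_; _<_; _∸_)
open import Data.List.Base using (List; []; _∷_; _++_; [_]; length; foldr)
open import Data.List.Membership.Propositional using (_∈_)
open import Data.List.Relation.Unary.All using (All)
open import Data.List.Relation.Unary.AllPairs using (AllPairs)
open import Data.List.Relation.Unary.Linked using (Linked)
open import Data.List.Relation.Unary.Unique.Propositional using (Unique)
open import Data.Product.Base using (Σ-syntax; _×_; _,_)
open import Data.Sum.Base using (_⊎_; inj₁; inj₂)
open import Relation.Binary.Core using (Rel)
open import Relation.Binary.Definitions using (Symmetric; Irreflexive)
open import Relation.Binary.PropositionalEquality using (_≡_)
open import Relation.Nullary.Negation.Core using (¬_)

private
  variable
    ℓ : Level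

-- V may be infinite. Edges are determined by their endpoints: different
-- inhabitants of Adj x y are the same edge.
record Graph (V : Set ℓ) : Set (lsuc ℓ) where
  field
    Adj        : Rel V ℓ
    Adj-sym    : Symmetric Adj
    Adj-irrefl : Irreflexive _≡_ Adj

open Graph public

-- An edge is named by either of its two ordered pairs of endpoints.
SameEdge : {V : Set ℓ} → V × V → V × V → Set ℓ
SameEdge (x , y) (u , v) = (x ≡ u × y ≡ v) ⊎ (x ≡ v × y ≡ u)

IsEdge : {V : Set ℓ} → Graph V → V × V → Set ℓ
IsEdge G (x , y) = Adj G x y

infixl 6 _─_ _─*_

_─_ : {V : Set ℓ} → Graph V → V × V → Graph V
Adj        (G ─ e) x y = Adj G x y × ¬ SameEdge (x , y) e
Adj-sym    (G ─ e) (a , n) = Adj-sym G a , λ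
  { (inj₁ (p , q)) → n (inj₂ (q , p))
  ; (inj₂ (p , q)) → n (inj₁ (q , p)) }
Adj-irrefl (G ─ e) x≡y (a , _) = Adj-irrefl G x≡y a

_─*_ : {V : Set ℓ} → Graph V → List (V × V) → Graph V
G ─* es = foldr (λ e H → H ─ e) G es

-- Paths are listed by their vertices, in order.
IsPath : {V : Set ℓ} → Graph V → List V → Set ℓ
IsPath G xs = Linked (Adj G) xs × Unique xs

HasPathOn : {V : Set ℓ} → Graph V → ℕ → Set ℓ
HasPathOn {V = V} G k = Σ[ xs ∈ List V ] IsPath G xs × length xs ≡ k

-- Cycles are listed by their vertices, in cyclic order, without repeating the
-- first one at the end; `close` repeats it.
close : {V : Set ℓ} → List V → List V
close []       = []
close (x ∷ xs) = x ∷ xs ++ [ x ]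

IsCycle : {V : Set ℓ} → Graph V → List V → Set ℓ
IsCycle G c = 3 ≤ length c × Unique c × Linked (Adj G) (close c)

consecutive : {V : Set ℓ} → List V → List (V × V)
consecutive []           = []
consecutive (x ∷ [])     = []
consecutive (x ∷ y ∷ zs) = (x , y) ∷ consecutive (y ∷ zs)

cycleEdges : {V : Set ℓ} → List V → List (V × V)
cycleEdges c = consecutive (close c)

EdgeDisjoint : {V : Set ℓ} → List V → List V → Set ℓ
EdgeDisjoint c d = ∀ {e f} → e ∈ cycleEdges c → f ∈ cycleEdges d → ¬ SameEdge e f

OnEdgeDisjointCycles : {V : Set ℓ} → Graph V → ℕ → V → Set ℓ
OnEdgeDisjointCycles {V = V} G k v =
  Σ[ cs ∈ List (List V) ]
    length cs ≡ k × All (λ c → IsCycle G c × v ∈ c) cs × AllPairs EdgeDisjoint cs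

Captured : {V : Set ℓ} → Graph V → V → Set ℓ
Captured G v = ∀ w → ¬ Adj G v w

-- The cat moves along a path u, is, v; listing both ends separately forces at
-- least one edge, and the absence of repetitions forces u and v to differ.
CatMove : {V : Set ℓ} → Graph V → V → V → Set ℓ
CatMove {V = V} G u v = Σ[ is ∈ List V ] IsPath G (u ∷ is ++ [ v ])

-- A player's own earlier moves are determined by the opponent's moves, so a
-- strategy need only look at the latter. Histories have the latest move first.
record CatStrategy (V : Set ℓ) : Set ℓ where
  field
    start   : V
    respond : List (V × V) → V

open CatStrategy public

-- The argument lists the positions of the cat so far, including its start.
HerderStrategy : Set ℓ → Set ℓ
HerderStrategy V = List V → V × V

module Play {V : Set ℓ} (G : Graph V) (σ : CatStrategy V) (τ : HerderStrategy V) where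

  mutual
    deletions : ℕ → List (V × V)
    deletions zero    = []
    deletions (suc n) = τ (visited n) ∷ deletions n

    visited : ℕ → List V
    visited zero    = [ start σ ]
    visited (suc n) = position (suc n) ∷ visited n

    position : ℕ → V
    position zero    = start σ
    position (suc n) = respond σ (deletions (suc n))

  current : ℕ → Graph V
  current n = G ─* deletions n

  -- Rounds are numbered from 0; round n is played from current n and position n.
  HerderLegal : ℕ → Set ℓ
  HerderLegal n = IsEdge (current n) (τ (visited n))

  CatLegal : ℕ → Set ℓ
  CatLegal n = CatMove (current (suc n)) (position n) (position (suc n))

  -- Strategies are total functions, so they may prescribe illegal moves; the
  -- cat is answerable only for plays in which the herder has deleted actual
  -- edges. The condition ¬ Captured says that the game is still on when the
  -- round begins. It matters only in round 0 of an edgeless graph, where the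
  -- herder has nothing to delete and the cat would otherwise evade vacuously.
  Evades : ℕ → Set ℓ
  Evades r = ∀ n → n < r → (∀ m → m < n → HerderLegal m) →
    ¬ Captured (current n) (position n) × (HerderLegal n → CatLegal n)

Evadible : {V : Set ℓ} → ℕ → Graph V → Set ℓ
Evadible {V = V} k G =
  Σ[ σ ∈ CatStrategy V ] (∀ (τ : HerderStrategy V) → Play.Evades G σ τ (k ∸ 1))

ωEvadible : {V : Set ℓ} → Graph V → Set ℓ
ωEvadible G = ∀ k → Evadible k G

{-# OPTIONS --safe #-}
module Submission where

-- Paths keep the cat alive by halving: a deletion spares one of the two arms at
-- an inner vertex of a long path, and the cat moves to the middle of that arm.
-- Cycles keep it alive because, from a vertex v on many edge-disjoint cycles,
-- it can step to the next vertex of an intact cycle and then return to v, on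
-- one side of the cycle or the other, and each deletion spoils only one cycle.
--
-- Suppose conversely that paths have fewer than N vertices and no vertex lies on
-- K edge-disjoint cycles. Fix a root r connected to the cat, and bound the
-- length of the paths starting at r. The herder deletes the at most K N edges of
-- a maximal family of edge-disjoint cycles through r. Then no cycle passes
-- through r, so the edge at r towards the cat is a bridge, which it deletes.
-- Whenever a deletion separates the cat from r, the far end b of the deleted
-- edge becomes the new root, and the bound drops, because a path starting at b
-- extends backwards over that edge to r. So the cat is caught in about
-- N (K N + 2) rounds.

open import Defs
open import Axiom.ExcludedMiddle using (ExcludedMiddle)
open import Data.Empty using (⊥-elim)
open import Data.List.Base using (List; []; _∷_; _++_; [_]; length; reverse; take; drop; concatMap)
open import Data.List.Membership.Propositional using (_∈_)
open import Data.List.Membership.Propositional.Properties using (∈-∃++; ∈-++⁺ʳ; ∈-concatMap⁺; ∈-length)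
open import Data.List.Properties using (++-assoc; length-++; length-reverse; unfold-reverse; take++drop≡id; length-take; drop-all; ∷-injectiveʳ)
open import Data.List.Relation.Binary.Permutation.Propositional using (_↭_; prep; ↭-sym; ↭-trans; ↭⇒↭ₛ)
open import Data.List.Relation.Binary.Permutation.Propositional.Properties using (++-comm; ↭-reverse; ↭-length)
import Data.List.Relation.Binary.Permutation.Setoid.Properties as Permutationₛ
open import Data.List.Relation.Unary.All as All using (All; []; _∷_)
import Data.List.Relation.Unary.All.Properties as All
open import Data.List.Relation.Unary.AllPairs using (AllPairs; []; _∷_)
open import Data.List.Relation.Unary.Any as Any using (here; there)
open import Data.List.Relation.Unary.Linked as Linked using (Linked; []; [-]; _∷_)
open import Data.List.Relation.Unary.Unique.Propositional using (Unique)
import Data.List.Relation.Unary.Unique.Propositional.Properties as Unique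
open import Data.Nat.Base using (ℕ; zero; suc; _+_; _*_; _∸_; _≤_; _<_; z≤n; s≤s)
open import Data.Nat.Properties
open import Data.Product.Base using (Σ-syntax; ∃-syntax; _×_; _,_; proj₁; proj₂; map₁; map₂)
open import Data.Sum.Base as Sum using (_⊎_; inj₁; inj₂; [_,_]′)
open import Data.Unit.Polymorphic.Base using (⊤; tt)
open import Function.Base using (_∘_)
open import Function.Bundles using (_⇔_; mk⇔)
open import Relation.Binary.Construct.Closure.ReflexiveTransitive as Star using (Star; ε; _◅_; _◅◅_)
open import Relation.Binary.Core using (Rel)
open import Relation.Binary.Definitions using (Symmetric)
open import Relation.Binary.PropositionalEquality using (_≡_; _≢_; refl; sym; trans; cong; subst; setoid; module ≡-Reasoning)
open import Relation.Nullary using (¬_; Dec; yes; no; contradiction)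
open import Relation.Nullary.Decidable using (decidable-stable)

-- Lists

module _ {a} {A : Set a} where

  module _ {R : Rel A a} where

    linked-split : ∀ xs {y ys} → Linked R (xs ++ y ∷ ys) → Linked R (xs ++ [ y ]) × Linked R (y ∷ ys)
    linked-split []           l       = [-] , l
    linked-split (x ∷ [])     (r ∷ l) = r ∷ [-] , l
    linked-split (x ∷ z ∷ xs) (r ∷ l) = map₁ (r ∷_) (linked-split (z ∷ xs) l)

    linked-join : ∀ xs {y ys} → Linked R (xs ++ [ y ]) → Linked R (y ∷ ys) → Linked R (xs ++ y ∷ ys)
    linked-join []           _       m = m
    linked-join (x ∷ [])     (r ∷ _) m = r ∷ m
    linked-join (x ∷ z ∷ xs) (r ∷ l) m = r ∷ linked-join (z ∷ xs) l m

    linked-++⁻ˡ : ∀ xs {ys} → Linked R (xs ++ ys) → Linked R xs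
    linked-++⁻ˡ []           _       = []
    linked-++⁻ˡ (x ∷ [])     _       = [-]
    linked-++⁻ˡ (x ∷ z ∷ xs) (r ∷ l) = r ∷ linked-++⁻ˡ (z ∷ xs) l

    linked-reverse : Symmetric R → ∀ xs {y} → Linked R (xs ++ [ y ]) → Linked R (y ∷ reverse xs)
    linked-reverse s []           _         = [-]
    linked-reverse s (x ∷ [])     (r ∷ [-]) = s r ∷ [-]
    linked-reverse s (x ∷ z ∷ xs) {y} (r ∷ l) = subst (Linked R ∘ (y ∷_)) eq
      (linked-join (y ∷ reverse xs)
        (subst (Linked R ∘ (y ∷_)) (unfold-reverse z xs) (linked-reverse s (z ∷ xs) l))
        (s r ∷ [-]))
      where
      open ≡-Reasoning
      eq : reverse xs ++ z ∷ x ∷ [] ≡ reverse (x ∷ z ∷ xs)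
      eq = begin
        reverse xs ++ z ∷ x ∷ []       ≡⟨ ++-assoc (reverse xs) [ z ] [ x ] ⟨
        (reverse xs ++ [ z ]) ++ [ x ] ≡⟨ cong (_++ [ x ]) (unfold-reverse z xs) ⟨
        reverse (z ∷ xs) ++ [ x ]      ≡⟨ unfold-reverse x (z ∷ xs) ⟨
        reverse (x ∷ z ∷ xs)           ∎

    linked⇒star : ∀ x xs {y} → Linked R (x ∷ xs ++ [ y ]) → Star R x y
    linked⇒star x []       (r ∷ _) = r ◅ ε
    linked⇒star x (z ∷ xs) (r ∷ l) = r ◅ linked⇒star z xs l

    linked-consecutive : ∀ {xs x y} → Linked R xs → (x , y) ∈ consecutive xs → R x y
    linked-consecutive (r ∷ l) (here refl) = r
    linked-consecutive (r ∷ l) (there p)   = linked-consecutive l p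

    linked-relabel : ∀ {S : Rel A a} {xs} → Linked R xs →
      (∀ {x y} → (x , y) ∈ consecutive xs → R x y → S x y) → Linked S xs
    linked-relabel []      f = []
    linked-relabel [-]     f = [-]
    linked-relabel (r ∷ l) f = f (here refl) r ∷ linked-relabel l (f ∘ there)

  length-consecutive : ∀ (x : A) xs → length (consecutive (x ∷ xs)) ≡ length xs
  length-consecutive x []       = refl
  length-consecutive x (y ∷ xs) = cong suc (length-consecutive y xs)

  unique-resp-↭ : ∀ {xs ys : List A} → xs ↭ ys → Unique xs → Unique ys
  unique-resp-↭ p = Permutationₛ.Unique-resp-↭ (setoid A) (↭⇒↭ₛ p)

  unique-split : ∀ xs {y : A} {ys} → Unique (xs ++ y ∷ ys) → Unique (xs ++ [ y ]) × Unique (y ∷ ys)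
  unique-split []       u       = [] ∷ [] , u
  unique-split (x ∷ xs) (n ∷ u) =
    map₁ (All.++⁺ (All.++⁻ˡ xs n) (All.head (All.++⁻ʳ xs n) ∷ []) ∷_) (unique-split xs u)

  split-at : ∀ n (xs : List A) → n < length xs →
    Σ[ ys ∈ List A ] ∃[ z ] Σ[ zs ∈ List A ] xs ≡ ys ++ z ∷ zs × length ys ≡ n
  split-at zero    (x ∷ xs) _       = [] , x , xs , refl , refl
  split-at (suc n) (x ∷ xs) (s≤s p) with split-at n xs p
  ... | ys , z , zs , refl , refl = x ∷ ys , z , zs , refl , refl

  headOr : A → List A → A
  headOr d []      = d
  headOr d (x ∷ _) = x

  drop-headOr : ∀ d (xs : List A) n → n < length xs → drop n xs ≡ headOr d (drop n xs) ∷ drop (suc n) xs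
  drop-headOr d (x ∷ xs) zero    _       = refl
  drop-headOr d (x ∷ xs) (suc n) (s≤s p) = drop-headOr d xs n p

-- Graphs

module _ {ℓ} {V : Set ℓ} where

  -- A record, so that H and G can be inferred from H ⊑ G.
  record _⊑_ (H G : Graph V) : Set ℓ where
    constructor ⟨_⟩
    field embed : ∀ {x y} → Adj H x y → Adj G x y

  open _⊑_

  ⊑-refl : ∀ (G : Graph V) → G ⊑ G
  ⊑-refl G = ⟨ (λ a → a) ⟩

  ⊑-trans : ∀ {G H K : Graph V} → G ⊑ H → H ⊑ K → G ⊑ K
  ⊑-trans p q = ⟨ (λ a → embed q (embed p a)) ⟩

  ─-⊑ : ∀ (G : Graph V) e → (G ─ e) ⊑ G
  ─-⊑ G e = ⟨ proj₁ ⟩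

  same-sym : ∀ {e f : V × V} → SameEdge e f → SameEdge f e
  same-sym (inj₁ (refl , refl)) = inj₁ (refl , refl)
  same-sym (inj₂ (refl , refl)) = inj₂ (refl , refl)

  same-trans : ∀ {e f g : V × V} → SameEdge e f → SameEdge f g → SameEdge e g
  same-trans (inj₁ (refl , refl)) s = s
  same-trans (inj₂ (refl , refl)) (inj₁ (refl , refl)) = inj₂ (refl , refl)
  same-trans (inj₂ (refl , refl)) (inj₂ (refl , refl)) = inj₁ (refl , refl)

  star-sym : ∀ (G : Graph V) {x y} → Star (Adj G) x y → Star (Adj G) y x
  star-sym G = Star.reverse (Adj-sym G)

  path-mono : ∀ {H G : Graph V} → H ⊑ G → ∀ {xs} → IsPath H xs → IsPath G xs
  path-mono H⊑G (l , u) = Linked.map (embed H⊑G) l , u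

  path-split : ∀ (G : Graph V) xs {y ys} → IsPath G (xs ++ y ∷ ys) → IsPath G (xs ++ [ y ]) × IsPath G (y ∷ ys)
  path-split G xs (l , u) =
    (proj₁ (linked-split xs l) , proj₁ (unique-split xs u)) ,
    (proj₂ (linked-split xs l) , proj₂ (unique-split xs u))

  cycle-mono : ∀ {H G : Graph V} → H ⊑ G → ∀ {c} → IsCycle H c → IsCycle G c
  cycle-mono H⊑G (3≤ , u , l) = 3≤ , u , Linked.map (embed H⊑G) l

  cycle⇒path : ∀ {G : Graph V} c → IsCycle G c → IsPath G c
  cycle⇒path []       _           = [] , []
  cycle⇒path (x ∷ xs) (_ , u , l) = linked-++⁻ˡ (x ∷ xs) l , u

  onCycles-mono : ∀ {H G : Graph V} → H ⊑ G → ∀ {k v} → OnEdgeDisjointCycles H k v → OnEdgeDisjointCycles G k v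
  onCycles-mono H⊑G (cs , len , cyc , dis) = cs , len , All.map (map₁ (cycle-mono H⊑G)) cyc , dis

  catMove⇒star : ∀ (G : Graph V) {u w} → CatMove G u w → Star (Adj G) u w
  catMove⇒star G (is , l , _) = linked⇒star _ is l

  linked-avoids : ∀ (G : Graph V) {xs p q e} → Linked (Adj G) xs → All (p ≢_) xs → SameEdge (p , q) e →
    Linked (Adj (G ─ e)) xs
  linked-avoids G []      _ _ = []
  linked-avoids G [-]     _ _ = [-]
  linked-avoids G {p = p} {q} (r ∷ l) (n₁ ∷ n₂ ∷ n) s =
    (r , λ t → endpoint (same-trans s (same-sym t))) ∷ linked-avoids G l (n₂ ∷ n) s
    where
    endpoint : ¬ SameEdge (p , q) _
    endpoint (inj₁ (p≡x , _)) = n₁ p≡x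
    endpoint (inj₂ (p≡y , _)) = n₂ p≡y

  -- Game values and strategies

  -- The value of the game freed from strategies and histories: only the state before a deletion and
  -- the number of remaining rounds matter, which allows induction.
  Survives : Graph V → V → ℕ → Set ℓ
  Survives H u zero    = ⊤
  Survives H u (suc n) = ¬ Captured H u ×
    (∀ e → IsEdge H e → Σ[ w ∈ V ] CatMove (H ─ e) u w × Survives (H ─ e) w n)

  survives-mono : ∀ {m n} → m ≤ n → ∀ H u → Survives H u n → Survives H u m
  survives-mono z≤n       H u _        = tt
  survives-mono (s≤s m≤n) H u (¬c , f) = ¬c , λ e he →
    let w , move , s = f e he in w , move , survives-mono m≤n (H ─ e) w s

  -- From evading strategies to game values

  Legal : Graph V → List (V × V) → Set ℓ
  Legal G []       = ⊤
  Legal G (e ∷ es) = IsEdge (G ─* es) e × Legal G es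

  located : CatStrategy V → List (V × V) → V
  located σ []       = start σ
  located σ (e ∷ es) = respond σ (e ∷ es)

  module _ (G : Graph V) (σ : CatStrategy V) (τ : HerderStrategy V) where
    open Play G σ τ

    length-visited : ∀ n → length (visited n) ≡ suc n
    length-visited zero    = refl
    length-visited (suc n) = cong suc (length-visited n)

    position-located : ∀ n → position n ≡ located σ (deletions n)
    position-located zero    = refl
    position-located (suc n) = refl

    legal-history : ∀ n → Legal G (deletions n) → ∀ m → m < n → HerderLegal m
    legal-history (suc n) (l , ls) m (s≤s m≤n) with m≤n⇒m<n∨m≡n m≤n
    ... | inj₁ m<n  = legal-history n ls m m<n
    ... | inj₂ refl = l

  -- A herder who plays a fixed history. The latest deletion stands first in `es`, and `us` has
  -- `n + 1` entries in round `n`, so round 0 reads the last entry of `es`. The default is read only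
  -- when `es` or `us` is empty.
  replay : CatStrategy V → List (V × V) → HerderStrategy V
  replay σ es us = headOr (start σ , start σ) (drop (length es ∸ length us) es)

  module _ (G : Graph V) (σ : CatStrategy V) (es : List (V × V)) where
    open Play G σ (replay σ es)

    deletions-replay : ∀ n → n ≤ length es → deletions n ≡ drop (length es ∸ n) es
    deletions-replay zero    _   = sym (drop-all (length es) es ≤-refl)
    deletions-replay (suc n) n<L
      rewrite length-visited G σ (replay σ es) n | deletions-replay n (<⇒≤ n<L) =
      sym (trans
        (drop-headOr (start σ , start σ) es (length es ∸ suc n)
          (subst (_≤ length es) (sym eq) (m∸n≤m (length es) n)))
        (cong (λ k → headOr (start σ , start σ) (drop (length es ∸ suc n) es) ∷ drop k es) eq))
      where
      eq : suc (length es ∸ suc n) ≡ length es ∸ n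
      eq = sym (+-∸-assoc 1 n<L)

    deletions-all : deletions (length es) ≡ es
    deletions-all = trans (deletions-replay (length es) ≤-refl) (cong (λ k → drop k es) (n∸n≡0 (length es)))

  module _ (G : Graph V) (σ : CatStrategy V) {r} (evades : ∀ τ → Play.Evades G σ τ r) where

    evades⇒¬captured : ∀ es → length es < r → Legal G es → ¬ Captured (G ─* es) (located σ es)
    evades⇒¬captured es L<r legal = subst (λ ds → ¬ Captured (G ─* ds) (located σ ds)) (deletions-all G σ es)
      (subst (λ u → ¬ Captured (current L) u) (position-located G σ τ L)
        (proj₁ (evades τ L L<r
          (legal-history G σ τ L (subst (Legal G) (sym (deletions-all G σ es)) legal)))))
      where
      L = length es
      τ = replay σ es
      open Play G σ τ

    evades⇒move : ∀ e es → length es < r → Legal G (e ∷ es) →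
      CatMove (G ─* (e ∷ es)) (located σ es) (respond σ (e ∷ es))
    evades⇒move e es L<r legal = subst (λ ds → CatMove (G ─* (e ∷ es)) (located σ ds) (respond σ (e ∷ es)))
      (∷-injectiveʳ all)
      (subst (λ ds → CatMove (G ─* ds) (located σ (deletions L)) (respond σ ds)) all
        (subst (λ u → CatMove (current (suc L)) u (position (suc L))) (position-located G σ τ L)
          (proj₂ (evades τ L L<r (λ m m<L → legal′ m (m<n⇒m<1+n m<L))) (legal′ L ≤-refl))))
      where
      L = length es
      -- With `e` included in the history, round `length es` is the one in which `e` is deleted.
      τ = replay σ (e ∷ es)
      open Play G σ τ
      all : deletions (suc L) ≡ e ∷ es
      all = deletions-all G σ (e ∷ es)
      legal′ : ∀ m → m < suc L → HerderLegal m
      legal′ = legal-history G σ τ (suc L) (subst (Legal G) (sym all) legal)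

    evades⇒survives : ∀ m es → length es + m ≡ r → Legal G es → Survives (G ─* es) (located σ es) m
    evades⇒survives zero    es _  _     = tt
    evades⇒survives (suc m) es eq legal = evades⇒¬captured es L<r legal , λ e he →
      respond σ (e ∷ es) , evades⇒move e es L<r (he , legal) ,
      evades⇒survives m (e ∷ es) (trans (sym (+-suc (length es) m)) eq) (he , legal)
      where
      L<r : length es < r
      L<r = subst (length es <_) eq (m<m+n (length es) (s≤s z≤n))

  evadible⇒survives : ∀ {G : Graph V} {k} → Evadible k G → Σ[ v ∈ V ] Survives G v (k ∸ 1)
  evadible⇒survives {G} {k} (σ , evades) = start σ , evades⇒survives G σ evades (k ∸ 1) [] refl tt

  module _ (em : ExcludedMiddle ℓ) where

    path-suffix : ∀ (G : Graph V) {u v} ys → u ∈ ys ++ [ v ] → IsPath G (ys ++ [ v ]) → u ≡ v ⊎ CatMove G u v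
    path-suffix G []       (here refl) _       = inj₁ refl
    path-suffix G (y ∷ ys) (here refl) p       = inj₂ (ys , p)
    path-suffix G (y ∷ ys) (there u∈)  (l , _ ∷ u) = path-suffix G ys u∈ (Linked.tail l , u)

    -- Loop erasure: when the new first vertex already lies on the path, `path-suffix` cuts the path
    -- there.
    star⇒path : ∀ (G : Graph V) {u v} → Star (Adj G) u v → u ≡ v ⊎ CatMove G u v
    star⇒path G ε = inj₁ refl
    star⇒path G {u} {v} (a ◅ s) with star⇒path G s
    ... | inj₁ refl = inj₂ ([] , a ∷ [-] , ((λ eq → Adj-irrefl G eq a) ∷ []) ∷ [] ∷ [])
    ... | inj₂ (is , l , uq) with em {u ∈ _ ∷ is ++ [ v ]}
    ...   | yes u∈ = path-suffix G (_ ∷ is) u∈ (l , uq)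
    ...   | no  u∉ = inj₂ (_ ∷ is , a ∷ l , All.¬Any⇒All¬ _ u∉ ∷ uq)

    -- If `e` occurs in the left arm, its earlier end is not repeated later on the path, so the
    -- right arm does not use `e`.
    half-survives : ∀ (G : Graph V) e xs {y ys} → IsPath G (xs ++ y ∷ ys) →
      Linked (Adj (G ─ e)) (xs ++ [ y ]) ⊎ Linked (Adj (G ─ e)) (y ∷ ys)
    half-survives G e []           _             = inj₁ [-]
    half-survives G e (x ∷ [])     {y} (r ∷ l , n ∷ u) with em {SameEdge (x , y) e}
    ... | yes s = inj₂ (linked-avoids G l n s)
    ... | no ¬s = inj₁ ((r , ¬s) ∷ [-])
    half-survives G e (x ∷ z ∷ xs) (r ∷ l , n ∷ u) with half-survives G e (z ∷ xs) (l , u)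
    ... | inj₂ m = inj₂ m
    ... | inj₁ m with em {SameEdge (x , z) e}
    ...   | yes s = inj₂ (linked-avoids G (proj₂ (linked-split (z ∷ xs) l)) (All.++⁻ʳ (z ∷ xs) n) s)
    ...   | no ¬s = inj₁ ((r , ¬s) ∷ m)

    -- From game values to evading strategies

    module _ (G : Graph V) (v : V) (r : ℕ) where

      -- ds includes the deletion that the move from u to w answers.
      Good : V → List (V × V) → V → Set ℓ
      Good u ds w = CatMove (G ─* ds) u w × Survives (G ─* ds) w (r ∸ length ds)

      -- `Survives` only asserts that answers exist; excluded middle selects one for each history.
      -- The fallback `v` never arises in the first `r` rounds of legal play from a surviving start.
      follow : List (V × V) → V
      follow []       = v
      follow (e ∷ es) with em {Σ[ w ∈ V ] Good (follow es) (e ∷ es) w}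
      ... | yes (w , _) = w
      ... | no  _       = v

      follow-good : ∀ e es → Σ[ w ∈ V ] Good (follow es) (e ∷ es) w → Good (follow es) (e ∷ es) (follow (e ∷ es))
      follow-good e es p with em {Σ[ w ∈ V ] Good (follow es) (e ∷ es) w}
      ... | yes (_ , g) = g
      ... | no ¬p       = contradiction p ¬p

      survivor : CatStrategy V
      survivor = record { start = v ; respond = follow }

      module _ (surv : Survives G v r) (τ : HerderStrategy V) where
        open Play G survivor τ

        length-deletions : ∀ n → length (deletions n) ≡ n
        length-deletions zero    = refl
        length-deletions (suc n) = cong suc (length-deletions n)

        position-follow : ∀ n → position n ≡ follow (deletions n)
        position-follow zero    = refl
        position-follow (suc n) = refl

        GoodAt : ℕ → Set ℓ
        GoodAt n = Survives (current n) (position n) (r ∸ n)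

        next : ∀ n → n < r → GoodAt n →
          ¬ Captured (current n) (position n) × (HerderLegal n → CatLegal n × GoodAt (suc n))
        -- `r ∸ n` is turned into a successor, so that `Survives` unfolds to its second clause.
        next n n<r s with r ∸ n | r ∸ suc n in eq | +-∸-assoc 1 n<r
        next n n<r (¬c , f) | _ | m | refl = ¬c , step
          where
          good-respects : ∀ {w} → Survives (current (suc n)) w m →
            Survives (current (suc n)) w (r ∸ length (deletions (suc n)))
          good-respects {w} = subst (Survives (current (suc n)) w)
            (sym (trans (cong (r ∸_) (length-deletions (suc n))) eq))
          step : HerderLegal n → CatLegal n × Survives (current (suc n)) (position (suc n)) m
          step legal with f (τ (visited n)) legal
          ... | w , move , s′ with follow-good (τ (visited n)) (deletions n)
                  (w , subst (λ u → CatMove (current (suc n)) u w) (position-follow n) move , good-respects s′)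
          ... | move″ , s″ =
            subst (λ u → CatMove (current (suc n)) u (position (suc n))) (sym (position-follow n)) move″ ,
            subst (Survives (current (suc n)) (position (suc n)))
              (trans (cong (r ∸_) (length-deletions (suc n))) eq) s″

        goodAt : ∀ n → n ≤ r → (∀ m → m < n → HerderLegal m) → GoodAt n
        goodAt zero    _   _     = surv
        goodAt (suc n) n<r legal =
          proj₂ (proj₂ (next n n<r (goodAt n (<⇒≤ n<r) (λ m m<n → legal m (m<n⇒m<1+n m<n)))) (legal n ≤-refl))

        survivor-evades : Evades r
        survivor-evades n n<r legal = map₂ (proj₁ ∘_) (next n n<r (goodAt n (<⇒≤ n<r) legal))

    survives⇒evadible : ∀ {G : Graph V} {k v} → Survives G v (k ∸ 1) → Evadible k G
    survives⇒evadible {G} {k} {v} s = survivor G v (k ∸ 1) , survivor-evades G v (k ∸ 1) s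

    -- Evading on long paths

    -- The invariant just before a deletion. The path may depend on `e`, since the deletion may
    -- spoil either arm at `v`.
    Robust : Graph V → V → ℕ → Set ℓ
    Robust H v L = ∀ e → Σ[ xs ∈ List V ] IsPath (H ─ e) (v ∷ xs) × L < length xs

    -- With `w` chosen so that `L` vertices lie between it and `v`, the arm back to `v` has `L + 1`
    -- vertices beyond `w` and the forward arm more than `L`; a deletion spares one of them.
    inner-robust : ∀ (H : Graph V) {v xs} L → IsPath H (v ∷ xs) → suc (L + L) < length xs →
      Σ[ w ∈ V ] CatMove H v w × Robust H w L
    inner-robust H {v} {xs} L p long with split-at L xs (≤-trans (s≤s (≤-trans (m≤m+n L L) (n≤1+n _))) long)
    ... | ys , w , zs , refl , refl = w , (ys , proj₁ (path-split H (v ∷ ys) p)) , robust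
      where
      L<zs : L < length zs
      L<zs = +-cancelˡ-< (suc L) L (length zs)
        (≤-trans long (≤-reflexive (trans (length-++ ys) (+-suc L (length zs)))))
      robust : Robust H w L
      robust e with half-survives H e (v ∷ ys) p
      ... | inj₂ l = zs , (l , proj₂ (unique-split (v ∷ ys) (proj₂ p))) , L<zs
      ... | inj₁ l = reverse (v ∷ ys) ,
        (linked-reverse (Adj-sym (H ─ e)) (v ∷ ys) l ,
          unique-resp-↭ (↭-trans (++-comm (v ∷ ys) [ w ]) (prep w (↭-sym (↭-reverse (v ∷ ys)))))
            (proj₁ (unique-split (v ∷ ys) (proj₂ p)))) ,
        ≤-reflexive (sym (length-reverse (v ∷ ys)))

    -- This is 2^n - 1: each round uses up a middle vertex and one of the two arms beside it.
    armLength : ℕ → ℕ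
    armLength zero    = zero
    armLength (suc n) = suc (armLength n + armLength n)

    robust⇒survives : ∀ n (H : Graph V) v → Robust H v (armLength n) → Survives H v n
    robust⇒survives zero    H v rob = tt
    robust⇒survives (suc n) H v rob = free , λ e _ →
      let xs , p , long = rob e
          w , move , rob′ = inner-robust (H ─ e) (armLength n) p long
      in w , move , robust⇒survives n (H ─ e) w rob′
      where
      free : ¬ Captured H v
      -- Any pair serves here: a path with at least one edge from `v` gives `v` a neighbour.
      free capt with rob (v , v)
      ... | _ ∷ _ , (a ∷ _ , _) , _ = capt _ (proj₁ a)

    paths⇒ωevadible : ∀ {G : Graph V} → (∀ k → HasPathOn G k) → ωEvadible G
    -- Beyond its first vertex the path has `2 + 2L` vertices, just above the threshold `1 + 2L` of
    -- `inner-robust`, where `L` is the arm length.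
    paths⇒ωevadible {G} paths k with paths (3 + (armLength (k ∸ 1) + armLength (k ∸ 1)))
    ... | v ∷ xs , p , eq =
      let w , _ , rob = inner-robust G (armLength (k ∸ 1)) p (≤-reflexive (sym (suc-injective eq)))
      in survives⇒evadible {k = k} (robust⇒survives (k ∸ 1) G w rob)

    -- Evading on edge-disjoint cycles

    rotate : ∀ (H : Graph V) {c v} → IsCycle H c → v ∈ c → Σ[ ds ∈ List V ] IsCycle H (v ∷ ds)
    rotate H cyc v∈ with ∈-∃++ v∈
    rotate H cyc               v∈ | []     , zs , refl = zs , cyc
    rotate H {v = v} (3≤ , u , l) v∈ | x ∷ ys , zs , refl = zs ++ x ∷ ys ,
      subst (3 ≤_) (↭-length perm) 3≤ , unique-resp-↭ perm u ,
      subst (Linked (Adj H) ∘ (v ∷_)) (sym (++-assoc zs (x ∷ ys) [ v ]))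
        (linked-join (v ∷ zs) (proj₂ halves) (proj₁ halves))
      where
      perm : x ∷ ys ++ v ∷ zs ↭ v ∷ zs ++ x ∷ ys
      perm = ++-comm (x ∷ ys) (v ∷ zs)
      halves : Linked (Adj H) (x ∷ ys ++ [ v ]) × Linked (Adj H) (v ∷ zs ++ [ x ])
      halves = linked-split (x ∷ ys)
        (subst (Linked (Adj H) ∘ (x ∷_)) (++-assoc ys (v ∷ zs) [ x ]) l)

    -- What the cat needs of a cycle through the edge `vy`: a way back to `v` that does not use this
    -- edge.
    Detour : Graph V → V → V → Set ℓ
    Detour H v y = Adj H v y × Star (Adj (H ─ (v , y))) y v

    -- The detour is the rest of the cycle. Its vertices are distinct and `z` is a third one, so
    -- each edge of the detour has an end other than `v` and `y`.
    cycle⇒detour : ∀ (H : Graph V) {v} ds → IsCycle H (v ∷ ds) → Σ[ y ∈ V ] Detour H v y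
    cycle⇒detour H []       (s≤s () , _)
    cycle⇒detour H (y ∷ []) (s≤s (s≤s ()) , _)
    cycle⇒detour H {v} (y ∷ z ∷ ds) (_ , (v≢y ∷ v≢) ∷ y≢ ∷ _ , a ∷ b ∷ l) = y , a ,
      (b , λ { (inj₁ (y≡v , _)) → v≢y (sym y≡v) ; (inj₂ (_ , z≡v)) → All.head v≢ (sym z≡v) }) ◅
      rest z ds l v≢ y≢
      where
      rest : ∀ x xs → Linked (Adj H) (x ∷ xs ++ [ v ]) → All (v ≢_) (x ∷ xs) → All (y ≢_) (x ∷ xs) →
        Star (Adj (H ─ (v , y))) x v
      rest x xs l (v≢x ∷ v≢) (y≢x ∷ y≢) with xs | l
      ... | []      | c ∷ _  = (c , avoid) ◅ ε
        where
        avoid : ¬ SameEdge (x , v) (v , y)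
        avoid (inj₁ (x≡v , _)) = v≢x (sym x≡v)
        avoid (inj₂ (x≡y , _)) = y≢x (sym x≡y)
      ... | x′ ∷ xs | c ∷ l′ = (c , avoid) ◅ rest x′ xs l′ v≢ y≢
        where
        avoid : ¬ SameEdge (x , x′) (v , y)
        avoid (inj₁ (x≡v , _)) = v≢x (sym x≡v)
        avoid (inj₂ (x≡y , _)) = y≢x (sym x≡y)

    onCycles⇒detour : ∀ (H : Graph V) {k v} → OnEdgeDisjointCycles H (suc k) v → Σ[ y ∈ V ] Detour H v y
    onCycles⇒detour H (c ∷ _ , _ , (cyc , v∈) ∷ _ , _) with rotate H cyc v∈
    ... | ds , cyc′ = cycle⇒detour H ds cyc′

    cycle-survives : ∀ (H : Graph V) e {c} → IsCycle H c → (∀ {f} → f ∈ cycleEdges c → ¬ SameEdge f e) →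
      IsCycle (H ─ e) c
    cycle-survives H e (3≤ , u , l) avoid = 3≤ , u , linked-relabel l (λ f∈ a → a , avoid f∈)

    -- By disjointness `e` lies on at most one of the cycles. That one is dropped, or the last one
    -- if `e` lies on none of those before it. The second component keeps disjointness available
    -- when `c` is put back.
    prune : ∀ (H : Graph V) e {v} k cs → length cs ≡ suc k →
      All (λ c → IsCycle H c × v ∈ c) cs → AllPairs EdgeDisjoint cs →
      Σ[ p ∈ OnEdgeDisjointCycles (H ─ e) k v ]
        (∀ d → All (EdgeDisjoint d) cs → All (EdgeDisjoint d) (proj₁ p))
    prune H e zero    cs       eq cycs dis = ([] , refl , [] , []) , λ _ _ → []
    prune H e (suc k) (c ∷ cs) eq ((cyc , v∈) ∷ cycs) (c# ∷ dis)
      with em {Σ[ f ∈ V × V ] f ∈ cycleEdges c × SameEdge f e}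
    ... | yes (f , f∈ , s) =
      (cs , suc-injective eq ,
        All.zipWith (λ { (c#d , cyc′ , v∈′) →
          cycle-survives H e cyc′ (λ g∈ t → c#d f∈ g∈ (same-trans s (same-sym t))) , v∈′ }) (c# , cycs) ,
        dis) ,
      λ { d (_ ∷ d#) → d# }
    ... | no ¬hit with prune H e k cs (suc-injective eq) cycs dis
    ...   | (cs′ , eq′ , cycs′ , dis′) , keeps =
      (c ∷ cs′ , cong suc eq′ , (cycle-survives H e cyc (λ g∈ t → ¬hit (_ , g∈ , t)) , v∈) ∷ cycs′ ,
        keeps c c# ∷ dis′) ,
      λ { d (d#c ∷ d#) → d#c ∷ keeps d d# }

    onCycles-delete : ∀ (H : Graph V) e {k v} → OnEdgeDisjointCycles H (suc k) v → OnEdgeDisjointCycles (H ─ e) k v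
    onCycles-delete H e {k} (cs , eq , cycs , dis) = proj₁ (prune H e k cs eq cycs dis)

    adj⇒catMove : ∀ (H : Graph V) {u w} → Adj H u w → CatMove H u w
    adj⇒catMove H a = [] , a ∷ [-] , ((λ eq → Adj-irrefl H eq a) ∷ []) ∷ [] ∷ []

    -- If the herder deletes `vy`, the detour is left; otherwise the edge itself leads back.
    detour-survives : ∀ (H : Graph V) e {v y} → Detour H v y → Star (Adj (H ─ e)) y v
    detour-survives H e {v} {y} (a , s) with em {SameEdge (v , y) e}
    ... | yes same = Star.map (map₂ (λ ¬t t → ¬t (same-trans t (same-sym same)))) s
    ... | no ¬same = Adj-sym (H ─ e) (a , ¬same) ◅ ε

    mutual
      -- The cat alternates between `v` and its neighbours. Each round costs at most one cycle, and
      -- the extra one leaves an intact cycle to step onto.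
      onCycles-survives : ∀ n (H : Graph V) {v} → OnEdgeDisjointCycles H (suc n) v → Survives H v n
      onCycles-survives zero    H cycs = tt
      onCycles-survives (suc n) H cycs =
        (λ capt → capt _ (proj₁ (proj₂ (onCycles⇒detour H cycs)))) , λ e _ →
        let cycs′ = onCycles-delete H e cycs
            y , det = onCycles⇒detour (H ─ e) cycs′
        in y , adj⇒catMove (H ─ e) (proj₁ det) , detour-end-survives n (H ─ e) det cycs′

      detour-end-survives : ∀ n (H : Graph V) {v y} → Detour H v y → OnEdgeDisjointCycles H (suc n) v → Survives H y n
      detour-end-survives zero    H det cycs = tt
      detour-end-survives (suc n) H {v} det cycs = (λ capt → capt v (Adj-sym H (proj₁ det))) , λ e _ →
        v , [ (λ y≡v → ⊥-elim (Adj-irrefl H (sym y≡v) (proj₁ det))) , (λ move → move) ]′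
              (star⇒path (H ─ e) (detour-survives H e det)) ,
        onCycles-survives n (H ─ e) (onCycles-delete H e cycs)

    cycles⇒ωevadible : ∀ {G : Graph V} → (∀ k → Σ[ v ∈ V ] OnEdgeDisjointCycles G k v) → ωEvadible G
    cycles⇒ωevadible {G} cycles k =
      survives⇒evadible {k = k} (onCycles-survives (k ∸ 1) G (proj₂ (cycles (suc (k ∸ 1)))))

    -- Capturing the cat

    star-delete : ∀ (H : Graph V) e {r u} → Star (Adj H) r u → Star (Adj (H ─ e)) r u ⊎
      Σ[ a ∈ V ] Σ[ b ∈ V ] SameEdge (a , b) e × Star (Adj (H ─ e)) r a × Star (Adj (H ─ e)) b u
    star-delete H e ε = inj₁ ε
    star-delete H e {r} (_◅_ {j = x} a s) with star-delete H e s | em {SameEdge (r , x) e}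
    ... | inj₁ t                    | no ¬s = inj₁ ((a , ¬s) ◅ t)
    ... | inj₂ (p , q , se , t , t′) | no ¬s = inj₂ (p , q , se , (a , ¬s) ◅ t , t′)
    ... | inj₁ t                    | yes s = inj₂ (r , x , s , ε , t)
    -- The walk crosses `e` here and again later. In the same direction, both crossings end at the
    -- same vertex and the later remainder is kept; in opposite directions, the later one returns to
    -- `r`, whence the remainder avoids `e`.
    ... | inj₂ (p , q , se , t , t′) | yes s with same-trans s (same-sym se)
    ...   | inj₁ (refl , refl) = inj₂ (r , x , s , ε , t′)
    ...   | inj₂ (refl , refl) = inj₁ t′

    linked-reaches : ∀ {R : Rel V ℓ} {x xs z} → Linked R (x ∷ xs) → z ∈ x ∷ xs → Star R x z
    linked-reaches l       (here refl) = ε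
    linked-reaches (r ∷ l) (there z∈)  = r ◅ linked-reaches l z∈

    -- The potential that decreases at each change of root; `length xs` is the number of edges of
    -- the path.
    Short : Graph V → V → ℕ → Set ℓ
    Short H r n = ∀ xs → IsPath H (r ∷ xs) → length xs < n

    -- A path starting across the deleted edge extends backwards to r.
    reroot : ∀ (H : Graph V) e {r u n} → IsEdge H e → Star (Adj H) r u → ¬ Star (Adj (H ─ e)) r u →
      Short H r (suc n) → Σ[ b ∈ V ] Star (Adj (H ─ e)) b u × Short (H ─ e) b n
    reroot H e {r} {u} {n} he s ¬s short with star-delete H e s
    ... | inj₁ t = contradiction t ¬s
    ... | inj₂ (a , b , same , ra , bu) = b , bu , shorter
      where
      edge : SameEdge (a , b) e → Adj H a b
      edge (inj₁ (refl , refl)) = he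
      edge (inj₂ (refl , refl)) = Adj-sym H he

      extend : ∀ ps {xs} → IsPath (H ─ e) (ps ++ [ a ]) →
        (∀ {z} → z ∈ ps ++ [ a ] → Star (Adj (H ─ e)) r z) →
        IsPath (H ─ e) (b ∷ xs) → IsPath H (ps ++ a ∷ b ∷ xs)
      extend ps {xs} (l , uq) reach (l′ , uq′) =
        linked-join ps (Linked.map proj₁ l) (edge same ∷ Linked.map proj₁ l′) ,
        -- A vertex common to the two parts would connect `r` to `u` through `b` without `e`.
        subst Unique (++-assoc ps [ a ] (b ∷ xs)) (Unique.++⁺ uq uq′ λ (z∈ , z∈′) →
          ¬s (reach z∈ ◅◅ star-sym (H ─ e) (linked-reaches l′ z∈′) ◅◅ bu))

      shorter : Short (H ─ e) b n
      shorter xs p with star⇒path (H ─ e) ra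
      ... | inj₁ refl = ≤-pred (short (b ∷ xs) (extend [] ([-] , [] ∷ []) (λ { (here refl) → ε }) p))
      ... | inj₂ (is , q) = ≤-trans (n≤1+n _) (≤-trans (m≤n+m (2 + length xs) (length is))
        (≤-pred (subst (_< suc n) (length-++ is) (short _ (extend (r ∷ is) q (linked-reaches (proj₁ q)) p)))))

    -- A move stays within a component, so `w` is connected to the old root if `u` still is, and to
    -- the new one otherwise.
    chase : ∀ (H : Graph V) e {r u w n} → IsEdge H e → Star (Adj H) r u → CatMove (H ─ e) u w →
      Short H r (suc n) →
      Star (Adj (H ─ e)) r w ⊎ (Σ[ b ∈ V ] Star (Adj (H ─ e)) b w × Short (H ─ e) b n)
    chase H e {r} {u} he s move short with em {Star (Adj (H ─ e)) r u}
    ... | yes t = inj₁ (t ◅◅ catMove⇒star (H ─ e) move)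
    ... | no ¬t with reroot H e he s ¬t short
    ...   | b , t , short′ = inj₂ (b , t ◅◅ catMove⇒star (H ─ e) move , short′)

    -- A path, unlike a walk, does not return to `r`, so it uses its first edge only once.
    first-step : ∀ (H : Graph V) {r u} → r ≢ u → Star (Adj H) r u →
      Σ[ x ∈ V ] Adj H r x × Star (Adj (H ─ (r , x))) x u
    first-step H r≢u s with star⇒path H s
    ... | inj₁ r≡u = contradiction r≡u r≢u
    ... | inj₂ ([]     , a ∷ _ , _)     = _ , a , ε
    ... | inj₂ (x ∷ is , a ∷ l , n ∷ _) = x , a ,
      linked⇒star x is (linked-avoids H l n (inj₁ (refl , refl)))

    -- A path from `r` to `x` without the edge `rx` has an inner vertex, so adding the edge closes a
    -- cycle of length at least 3.
    close-cycle : ∀ (H : Graph V) {r x} → Adj H r x → Star (Adj (H ─ (r , x))) r x →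
      Σ[ c ∈ List V ] IsCycle H c × r ∈ c
    close-cycle H {r} {x} a s with star⇒path (H ─ (r , x)) s
    ... | inj₁ r≡x = ⊥-elim (Adj-irrefl H r≡x a)
    ... | inj₂ ([] , (_ , ¬same) ∷ _ , _) = ⊥-elim (¬same (inj₁ (refl , refl)))
    ... | inj₂ (y ∷ is , l , u) = r ∷ y ∷ is ++ [ x ] ,
      (s≤s (s≤s (∈-length (∈-++⁺ʳ is (here refl)))) , u ,
        subst (Linked (Adj H) ∘ (r ∷_) ∘ (y ∷_)) (sym (++-assoc is [ x ] [ r ]))
          (linked-join (r ∷ y ∷ is) (Linked.map proj₁ l) (Adj-sym H a ∷ [-]))) ,
      here refl

    -- `D` is the herder's list of pending deletions; once it is empty, no cycle passes through `r`.
    Hits : Graph V → V → List (V × V) → Set ℓ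
    Hits H r D = ∀ c → IsCycle H c → r ∈ c →
      Σ[ f ∈ V × V ] Σ[ g ∈ V × V ] f ∈ cycleEdges c × g ∈ D × SameEdge f g

    hits-mono : ∀ {H H′ : Graph V} → H′ ⊑ H → ∀ {r D} → Hits H r D → Hits H′ r D
    hits-mono H′⊑H hits c cyc = hits c (cycle-mono H′⊑H cyc)

    hits-drop : ∀ (H : Graph V) {r g D} → ¬ IsEdge H g → Hits H r (g ∷ D) → Hits H r D
    hits-drop H {g = g} ¬g hits c cyc r∈ with hits c cyc r∈
    ... | f , h , f∈ , there h∈  , s = f , h , f∈ , h∈ , s
    ... | f , _ , f∈ , here refl , s with linked-consecutive (proj₂ (proj₂ cyc)) f∈ | s
    ...   | a | inj₁ (refl , refl) = ⊥-elim (¬g a)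
    ...   | a | inj₂ (refl , refl) = ⊥-elim (¬g (Adj-sym H a))

    hits-delete : ∀ (H : Graph V) {r g D} → Hits H r (g ∷ D) → Hits (H ─ g) r D
    hits-delete H {g = g} hits =
      hits-drop (H ─ g) (λ (_ , ¬same) → ¬same (inj₁ (refl , refl))) (hits-mono (─-⊑ H g) hits)

    last-success : ∀ {P : ℕ → Set ℓ} k → P 0 → ¬ P k → Σ[ j ∈ ℕ ] j ≤ k × P j × ¬ P (suc j)
    last-success zero    p0 ¬pk = contradiction p0 ¬pk
    last-success {P} (suc k) p0 ¬pk with em {P k}
    ... | yes pk = k , n≤1+n k , pk , ¬pk
    ... | no ¬pk′ with last-success k p0 ¬pk′
    ...   | j , j≤k , pj , ¬psj = j , m≤n⇒m≤1+n j≤k , pj , ¬psj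

    module _ (G : Graph V) (N K : ℕ) (no-path : ¬ HasPathOn G N)
             (no-cycles : ∀ v → ¬ OnEdgeDisjointCycles G K v) where

      -- A longer path would have an initial segment on exactly `N` vertices.
      path-short : ∀ xs → IsPath G xs → length xs < N
      path-short xs (l , u) = ≰⇒> λ N≤ → no-path
        (take N xs ,
         (linked-++⁻ˡ (take N xs) (subst (Linked (Adj G)) (sym (take++drop≡id N xs)) l) , Unique.take⁺ N u) ,
         trans (length-take N xs) (m≤n⇒m⊓n≡m N≤))

      cycleEdges-short : ∀ c → IsCycle G c → length (cycleEdges c) ≤ N
      cycleEdges-short []       cyc = z≤n
      cycleEdges-short (x ∷ xs) cyc = ≤-trans
        (≤-reflexive (trans (length-consecutive x (xs ++ [ x ]))
          (trans (length-++ xs) (+-comm (length xs) 1))))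
        (<⇒≤ (path-short (x ∷ xs) (cycle⇒path {G} (x ∷ xs) cyc)))

      concatMap-short : ∀ {v} cs → All (λ c → IsCycle G c × v ∈ c) cs → length (concatMap cycleEdges cs) ≤ length cs * N
      concatMap-short []       []                 = z≤n
      concatMap-short (c ∷ cs) ((cyc , _) ∷ cycs) = ≤-trans (≤-reflexive (length-++ (cycleEdges c)))
        (+-mono-≤ (cycleEdges-short c cyc) (concatMap-short cs cycs))

      -- A cycle through `r` that shares no edge with a maximal edge-disjoint family would enlarge
      -- it. The family has at most `K` cycles with at most `N` edges each.
      hitting-set : ∀ {H : Graph V} → H ⊑ G → ∀ r → Σ[ D ∈ List (V × V) ] length D ≤ K * N × Hits H r D
      hitting-set {H} H⊑G r
        with last-success {λ k → OnEdgeDisjointCycles H k r} K ([] , refl , [] , [])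
               (no-cycles r ∘ onCycles-mono H⊑G {K})
      ... | j , j≤K , (cs , refl , cycs , dis) , maximal =
        concatMap cycleEdges cs ,
        ≤-trans (concatMap-short cs (All.map (map₁ (cycle-mono H⊑G)) cycs)) (*-monoˡ-≤ N j≤K) ,
        hits
        where
        Meets : List V → List (V × V) → Set ℓ
        Meets c D = Σ[ f ∈ V × V ] Σ[ g ∈ V × V ] f ∈ cycleEdges c × g ∈ D × SameEdge f g
        hits : Hits H r (concatMap cycleEdges cs)
        hits c cyc r∈ = decidable-stable (em {Meets c (concatMap cycleEdges cs)}) λ ¬meets →
          maximal (c ∷ cs , refl , (cyc , r∈) ∷ cycs ,
            All.tabulate (λ {d} d∈ {f} {g} f∈ g∈ s →
              ¬meets (f , g , f∈ , ∈-concatMap⁺ cycleEdges (Any.map (λ { refl → g∈ }) d∈) , s)) ∷ dis)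

      -- For each root, `K * N` rounds destroy the cycles through it, one drives the cat off it, and
      -- one deletes the bridge.
      bound : ℕ → ℕ
      bound zero    = zero
      bound (suc n) = K * N + (2 + bound n)

      mutual
        caught : ∀ n {H : Graph V} → H ⊑ G → ∀ {r u} → Star (Adj H) r u → Short H r n →
          ¬ Survives H u (bound n)
        -- The one-vertex path already violates the bound 0.
        caught zero    H⊑G s short _ with short [] ([-] , [] ∷ [])
        ... | ()
        caught (suc n) {H} H⊑G {r} {u} s short surv with hitting-set H⊑G r
        ... | D , D≤ , hits = caught-hitting n D H⊑G s short hits
          (survives-mono (+-monoˡ-≤ (2 + bound n) D≤) H u surv)

        -- Induction on the pending deletions. Either the cat stays connected to `r` and the list
        -- shrinks, or a new root has a smaller path bound and enough rounds remain for it.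
        caught-hitting : ∀ n D {H : Graph V} → H ⊑ G → ∀ {r u} → Star (Adj H) r u → Short H r (suc n) →
          Hits H r D → ¬ Survives H u (length D + (2 + bound n))
        caught-hitting n [] {H} H⊑G {r} {u} s short hits surv with em {r ≡ u}
        ... | no r≢u = caught-off-root n H⊑G r≢u s short hits (survives-mono (n≤1+n _) H u surv)
        ... | yes refl = proj₁ surv λ x a → caught-at-root n H⊑G a short hits surv
        caught-hitting n (g ∷ D) {H} H⊑G {r} {u} s short hits surv with em {IsEdge H g}
        ... | no ¬g = caught-hitting n D H⊑G s short (hits-drop H ¬g hits) (survives-mono (n≤1+n _) H u surv)
        ... | yes a with proj₂ surv g a
        ...   | w , move , surv′ with chase H g a s move short
        ...     | inj₁ t = caught-hitting n D (⊑-trans (─-⊑ H g) H⊑G) t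
          (λ xs p → short xs (path-mono (─-⊑ H g) p)) (hits-delete H hits) surv′
        ...     | inj₂ (b , t , short′) = caught n (⊑-trans (─-⊑ H g) H⊑G) t short′
          (survives-mono (≤-trans (m≤n+m (bound n) 2) (m≤n+m (2 + bound n) (length D))) (H ─ g) w surv′)

        -- A move ends at a different vertex, so any deletion drives the cat off `r`; `rx` is simply
        -- an edge at hand.
        caught-at-root : ∀ n {H : Graph V} → H ⊑ G → ∀ {r x} → Adj H r x → Short H r (suc n) →
          Hits H r [] → ¬ Survives H r (2 + bound n)
        caught-at-root n {H} H⊑G {r} {x} a short hits surv with proj₂ surv (r , x) a
        ... | w , move@(_ , _ , r∉ ∷ _) , surv′ = caught-off-root n (⊑-trans (─-⊑ H (r , x)) H⊑G)
          (All.lookup r∉ (∈-++⁺ʳ _ (here refl))) (catMove⇒star (H ─ (r , x)) move)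
          (λ xs p → short xs (path-mono (─-⊑ H (r , x)) p)) (hits-mono (─-⊑ H (r , x)) hits) surv′

        -- The edge at r towards the cat is a bridge, as no cycle passes through r.
        caught-off-root : ∀ n {H : Graph V} → H ⊑ G → ∀ {r u} → r ≢ u → Star (Adj H) r u → Short H r (suc n) →
          Hits H r [] → ¬ Survives H u (1 + bound n)
        caught-off-root n {H} H⊑G {r} r≢u s short hits surv with first-step H r≢u s
        ... | x , a , xu with proj₂ surv (r , x) a
        ...   | w , move , surv′ with chase H (r , x) a s move short
        ...     | inj₂ (b , t , short′) = caught n (⊑-trans (─-⊑ H (r , x)) H⊑G) t short′ surv′
        -- If `r` still reaches the cat, it also reaches `x` without the edge `rx`, which then lies
        -- on a cycle through `r`.
        ...     | inj₁ t with close-cycle H a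
                    (t ◅◅ star-sym (H ─ (r , x)) (xu ◅◅ catMove⇒star (H ─ (r , x)) move))
        ...       | c , cyc , r∈ with hits c cyc r∈
        ...         | _ , _ , _ , () , _

      ¬ωevadible : ¬ ωEvadible G
      -- `Evadible k` promises `k ∸ 1` moves, hence the successor. The cat's start serves as the
      -- first root.
      ¬ωevadible ev with evadible⇒survives {k = suc (bound N)} (ev (suc (bound N)))
      ... | v , surv = caught N (⊑-refl G) ε (λ xs p → <-trans (n<1+n _) (path-short (v ∷ xs) p)) surv

    ¬∀⇒∃¬ : ∀ {P : ℕ → Set ℓ} → ¬ (∀ k → P k) → Σ[ k ∈ ℕ ] ¬ P k
    ¬∀⇒∃¬ {P} ¬p = decidable-stable em′ λ ¬ex → ¬p λ k → decidable-stable em λ ¬pk → ¬ex (k , ¬pk)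
      where
      em′ : Dec (Σ[ k ∈ ℕ ] ¬ P k)
      em′ = em

    ωevadible⇒paths⊎cycles : ∀ {G : Graph V} → ωEvadible G →
      (∀ k → HasPathOn G k) ⊎ (∀ k → Σ[ v ∈ V ] OnEdgeDisjointCycles G k v)
    ωevadible⇒paths⊎cycles {G} ev with em {∀ k → HasPathOn G k}
    ... | yes paths = inj₁ paths
    ... | no ¬paths with em {∀ k → Σ[ v ∈ V ] OnEdgeDisjointCycles G k v}
    ...   | yes cycles = inj₂ cycles
    ...   | no ¬cycles with ¬∀⇒∃¬ ¬paths | ¬∀⇒∃¬ ¬cycles
    ...     | N , no-path | K , no-cycles =
      ⊥-elim (¬ωevadible G N K no-path (λ v cycs → no-cycles (v , cycs)) ev)

mainTheorem19 : ∀ {ℓ} → ExcludedMiddle ℓ →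
    {V : Set ℓ} (G : Graph V) →
    ωEvadible G ⇔
    ((∀ k → HasPathOn G k) ⊎ (∀ k → Σ[ v ∈ V ] OnEdgeDisjointCycles G k v))
mainTheorem19 em G = mk⇔ (ωevadible⇒paths⊎cycles em) [ paths⇒ωevadible em , cycles⇒ωevadible em ]′
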